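{- Let $x\in\mathbb{R}$ with $x\geq 2$. Then $$P_a(x)\,P_b(x)>P_{a+b}(x)$$ for all positive integers $a$ and $b$ satisfying $a+b\geq 12$.
   Context: Let $\sigma_2(n)=\sum_{d\mid n}d^2$. The polynomials $P_n(x)$ are defined by $P_0(x)=1$ and $P_n(x)=\frac{x}{n}\sum_{k=1}^n\sigma_2(k)\,P_{n-k}(x)$ for $n\geq1$; equivalently $\sum_{n\ge0}P_n(x)q^n=\prod_{n\ge1}(1-q^n)^{ -nx}$. -}

module Defs where

open import Data.Nat as ℕ using (ℕ; zero; suc)
import Data.Nat.Properties as ℕₚ
open import Data.Nat.Divisibility using (_∣?_)
open import Data.Nat.ListAction using (sum)
open import Data.Integer using (+_)
open import Data.Rational
open import Data.Rational.Properties
open import Data.Rational.Solver using (module +-*-Solver)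
open import Data.Fin using (Fin; zero; suc; toℕ)
open import Data.List using (List; map; filter; upTo)
open import Data.Vec using (Vec; []; _∷_; head; lookup)
open import Data.Vec.Functional using (foldr)
open import Data.Product using (∃-syntax; _×_; _,_)
open import Relation.Binary.PropositionalEquality

IsCauchy : (ℕ → ℚ) → Set
IsCauchy s = ∀ ε → 0ℚ < ε →
  ∃[ N ] (∀ m n → N ℕ.≤ m → N ℕ.≤ n → ∣ s m - s n ∣ < ε)

private

  pos-* : ∀ p q → 0ℚ < p → 0ℚ < q → 0ℚ < p * q
  pos-* p q 0<p 0<q = positive⁻¹ (p * q)
    {{ pos*pos⇒pos p {{positive 0<p}} q {{positive 0<q}} }}

  half-pos : ∀ ε → 0ℚ < ε → 0ℚ < ½ * ε
  half-pos ε = pos-* ½ ε (positive⁻¹ ½)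

  halves : ∀ ε → ½ * ε + ½ * ε ≡ ε
  halves ε = trans (sym (*-distribʳ-+ ε ½ ½)) (*-identityˡ ε)

  cauchy-const : ∀ q → IsCauchy (λ _ → q)
  cauchy-const q ε 0<ε = 0 , λ _ _ _ _ →
    subst (_< ε) (sym (cong ∣_∣ (+-inverseʳ q))) 0<ε

  cauchy-+ : ∀ s t → IsCauchy s → IsCauchy t → IsCauchy (λ n → s n + t n)
  cauchy-+ s t cs ct ε 0<ε
    with cs (½ * ε) (half-pos ε 0<ε) | ct (½ * ε) (half-pos ε 0<ε)
  ... | M , hs | N , ht = M ℕ.⊔ N , λ m n m≥ n≥ → begin-strict
    ∣ (s m + t m) - (s n + t n) ∣
      ≡⟨ cong ∣_∣ (regroup (s m) (t m) (s n) (t n)) ⟩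
    ∣ (s m - s n) + (t m - t n) ∣
      ≤⟨ ∣p+q∣≤∣p∣+∣q∣ (s m - s n) (t m - t n) ⟩
    ∣ s m - s n ∣ + ∣ t m - t n ∣
      <⟨ +-mono-< (hs m n (ℕₚ.m⊔n≤o⇒m≤o M N m≥) (ℕₚ.m⊔n≤o⇒m≤o M N n≥))
                  (ht m n (ℕₚ.m⊔n≤o⇒n≤o M N m≥) (ℕₚ.m⊔n≤o⇒n≤o M N n≥)) ⟩
    ½ * ε + ½ * ε
      ≡⟨ halves ε ⟩
    ε ∎
    where
    open ≤-Reasoning
    open +-*-Solver
    regroup : ∀ a b c d → (a + b) - (c + d) ≡ (a - c) + (b - d)
    regroup = solve 4 (λ a b c d →
      (a :+ b) :- (c :+ d) := (a :- c) :+ (b :- d)) refl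

  bounded : ∀ s → IsCauchy s →
    ∃[ B ] (0ℚ < B × ∃[ N ] (∀ n → N ℕ.≤ n → ∣ s n ∣ ≤ B))
  bounded s cs with cs 1ℚ (positive⁻¹ 1ℚ)
  ... | N , h = 1ℚ + ∣ s N ∣
              , +-mono-<-≤ (positive⁻¹ 1ℚ) (0≤∣p∣ (s N))
              , N , λ n n≥ → begin
    ∣ s n ∣                   ≡⟨ cong ∣_∣ (split (s n) (s N)) ⟩
    ∣ (s n - s N) + s N ∣     ≤⟨ ∣p+q∣≤∣p∣+∣q∣ (s n - s N) (s N) ⟩
    ∣ s n - s N ∣ + ∣ s N ∣   ≤⟨ +-monoˡ-≤ ∣ s N ∣ (<⇒≤ (h n N n≥ ℕₚ.≤-refl)) ⟩
    1ℚ + ∣ s N ∣              ∎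
    where
    open ≤-Reasoning
    open +-*-Solver
    split : ∀ a b → a ≡ (a - b) + b
    split = solve 2 (λ a b → a := (a :- b) :+ b) refl

  scaled : ∀ B → 0ℚ < B → ∀ ε → 0ℚ < ε → ∃[ δ ] (0ℚ < δ × B * δ ≡ ½ * ε)
  scaled B 0<B ε 0<ε = inv * (½ * ε)
    , pos-* inv (½ * ε) (positive⁻¹ inv {{1/pos⇒pos B {{B>0}}}}) (half-pos ε 0<ε)
    , trans (sym (*-assoc B inv (½ * ε)))
        (trans (cong (_* (½ * ε)) (*-inverseʳ B {{B≢0}})) (*-identityˡ (½ * ε)))
    where
    B>0 : Positive B
    B>0 = positive 0<B
    B≢0 : NonZero B
    B≢0 = pos⇒nonZero B {{B>0}}
    inv : ℚ
    inv = (1/ B) {{B≢0}}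

  prod-bound : ∀ p q B δ → 0ℚ < B → ∣ p ∣ ≤ B → ∣ q ∣ < δ → ∣ p * q ∣ < B * δ
  prod-bound p q B δ 0<B p≤B q<δ = begin-strict
    ∣ p * q ∣      ≡⟨ ∣p*q∣≡∣p∣*∣q∣ p q ⟩
    ∣ p ∣ * ∣ q ∣  ≤⟨ *-monoʳ-≤-nonNeg ∣ q ∣ {{∣-∣-nonNeg q}} p≤B ⟩
    B * ∣ q ∣      <⟨ *-monoʳ-<-pos B {{positive 0<B}} q<δ ⟩
    B * δ          ∎
    where open ≤-Reasoning

  prod-close : ∀ a b c d A B δ η ε → 0ℚ < A → 0ℚ < B →
    B * δ ≡ ½ * ε → A * η ≡ ½ * ε → ∣ a ∣ ≤ A → ∣ d ∣ ≤ B →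
    ∣ a - c ∣ < δ → ∣ b - d ∣ < η → ∣ a * b - c * d ∣ < ε
  prod-close a b c d A B δ η ε 0<A 0<B Bδ Aη a≤A d≤B ac bd = begin-strict
    ∣ a * b - c * d ∣
      ≡⟨ cong ∣_∣ (regroup a b c d) ⟩
    ∣ a * (b - d) + d * (a - c) ∣
      ≤⟨ ∣p+q∣≤∣p∣+∣q∣ (a * (b - d)) (d * (a - c)) ⟩
    ∣ a * (b - d) ∣ + ∣ d * (a - c) ∣
      <⟨ +-mono-< (prod-bound a (b - d) A η 0<A a≤A bd)
                  (prod-bound d (a - c) B δ 0<B d≤B ac) ⟩
    A * η + B * δ
      ≡⟨ cong₂ _+_ Aη Bδ ⟩
    ½ * ε + ½ * ε
      ≡⟨ halves ε ⟩
    ε ∎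
    where
    open ≤-Reasoning
    open +-*-Solver
    regroup : ∀ a b c d → a * b - c * d ≡ a * (b - d) + d * (a - c)
    regroup = solve 4 (λ a b c d →
      a :* b :- c :* d := a :* (b :- d) :+ d :* (a :- c)) refl

  cauchy-* : ∀ s t → IsCauchy s → IsCauchy t → IsCauchy (λ n → s n * t n)
  cauchy-* s t cs ct ε 0<ε =
    let A , 0<A , K , hA = bounded s cs
        B , 0<B , L , hB = bounded t ct
        δ , 0<δ , Bδ = scaled B 0<B ε 0<ε
        η , 0<η , Aη = scaled A 0<A ε 0<ε
        M , hs = cs δ 0<δ
        N , ht = ct η 0<η
    in combine A B δ η K L M N 0<A 0<B Bδ Aη hA hB hs ht
    where
    combine : ∀ A B δ η K L M N → 0ℚ < A → 0ℚ < B →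
      B * δ ≡ ½ * ε → A * η ≡ ½ * ε →
      (∀ n → K ℕ.≤ n → ∣ s n ∣ ≤ A) → (∀ n → L ℕ.≤ n → ∣ t n ∣ ≤ B) →
      (∀ m n → M ℕ.≤ m → M ℕ.≤ n → ∣ s m - s n ∣ < δ) →
      (∀ m n → N ℕ.≤ m → N ℕ.≤ n → ∣ t m - t n ∣ < η) →
      ∃[ Z ] (∀ m n → Z ℕ.≤ m → Z ℕ.≤ n → ∣ s m * t m - s n * t n ∣ < ε)
    combine A B δ η K L M N 0<A 0<B Bδ Aη hA hB hs ht =
      (K ℕ.⊔ L) ℕ.⊔ (M ℕ.⊔ N) , λ m n m≥ n≥ →
        prod-close (s m) (t m) (s n) (t n) A B δ η ε 0<A 0<B Bδ Aη
          (hA m (≥K m≥)) (hB n (≥L n≥))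
          (hs m n (≥M m≥) (≥M n≥)) (ht m n (≥N m≥) (≥N n≥))
      where
      ≥K : ∀ {n} → (K ℕ.⊔ L) ℕ.⊔ (M ℕ.⊔ N) ℕ.≤ n → K ℕ.≤ n
      ≥K h = ℕₚ.m⊔n≤o⇒m≤o K L (ℕₚ.m⊔n≤o⇒m≤o (K ℕ.⊔ L) (M ℕ.⊔ N) h)
      ≥L : ∀ {n} → (K ℕ.⊔ L) ℕ.⊔ (M ℕ.⊔ N) ℕ.≤ n → L ℕ.≤ n
      ≥L h = ℕₚ.m⊔n≤o⇒n≤o K L (ℕₚ.m⊔n≤o⇒m≤o (K ℕ.⊔ L) (M ℕ.⊔ N) h)
      ≥M : ∀ {n} → (K ℕ.⊔ L) ℕ.⊔ (M ℕ.⊔ N) ℕ.≤ n → M ℕ.≤ n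
      ≥M h = ℕₚ.m⊔n≤o⇒m≤o M N (ℕₚ.m⊔n≤o⇒n≤o (K ℕ.⊔ L) (M ℕ.⊔ N) h)
      ≥N : ∀ {n} → (K ℕ.⊔ L) ℕ.⊔ (M ℕ.⊔ N) ℕ.≤ n → N ℕ.≤ n
      ≥N h = ℕₚ.m⊔n≤o⇒n≤o M N (ℕₚ.m⊔n≤o⇒n≤o (K ℕ.⊔ L) (M ℕ.⊔ N) h)

-- Real numbers: Cauchy sequences of rationals.  Two sequences whose
-- difference tends to 0 represent the same real; the operations and the
-- order relations below respect this identification.

record ℝ : Set where
  constructor mkℝ
  field
    seq    : ℕ → ℚ
    cauchy : IsCauchy seq

open ℝ public

-- The Cauchy proofs are abstract so that comparing reals never unfolds them.
abstract
  const-isCauchy : ∀ q → IsCauchy (λ _ → q)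
  const-isCauchy = cauchy-const

  +-isCauchy : ∀ x y → IsCauchy (λ n → seq x n + seq y n)
  +-isCauchy x y = cauchy-+ (seq x) (seq y) (cauchy x) (cauchy y)

  *-isCauchy : ∀ x y → IsCauchy (λ n → seq x n * seq y n)
  *-isCauchy x y = cauchy-* (seq x) (seq y) (cauchy x) (cauchy y)

fromℚ : ℚ → ℝ
fromℚ q = mkℝ (λ _ → q) (const-isCauchy q)

fromℕ : ℕ → ℝ
fromℕ n = fromℚ (+ n / 1)

infixl 6 _+ℝ_
infixl 7 _*ℝ_ _/ℝ_
infix  4 _<ℝ_ _>ℝ_ _≤ℝ_ _≥ℝ_

_+ℝ_ : ℝ → ℝ → ℝ
x +ℝ y = mkℝ (λ n → seq x n + seq y n) (+-isCauchy x y)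

_*ℝ_ : ℝ → ℝ → ℝ
x *ℝ y = mkℝ (λ n → seq x n * seq y n) (*-isCauchy x y)

_/ℝ_ : ℝ → (n : ℕ) → .{{_ : ℕ.NonZero n}} → ℝ
x /ℝ n = x *ℝ fromℚ (+ 1 / n)

-- Strict order: the sequences are eventually separated by a fixed gap.
_<ℝ_ : ℝ → ℝ → Set
x <ℝ y = ∃[ ε ] (0ℚ < ε × ∃[ N ] (∀ n → N ℕ.≤ n → seq x n + ε < seq y n))

-- Termwise comparison is only required up to an arbitrary ε, since
-- seq x n may exceed seq y n for every n even when x and y are equal.
_≤ℝ_ : ℝ → ℝ → Set
x ≤ℝ y = ∀ ε → 0ℚ < ε → ∃[ N ] (∀ n → N ℕ.≤ n → seq x n < seq y n + ε)

_>ℝ_ _≥ℝ_ : ℝ → ℝ → Set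
x >ℝ y = y <ℝ x
x ≥ℝ y = y ≤ℝ x

sumℝ : ∀ {n} → (Fin n → ℝ) → ℝ
sumℝ = foldr _+ℝ_ (fromℕ 0)

divisors : ℕ → List ℕ
divisors n = filter (_∣? n) (map suc (upTo n))

σ₂ : ℕ → ℕ
σ₂ n = sum (map (ℕ._^ 2) (divisors n))

-- Given Pₙ(x), …, P₀(x) in this order, the value of Pₙ₊₁(x).  The index i
-- stands for k = i + 1, so the i-th entry is Pₙ₊₁₋ₖ(x).
next : ∀ {n} → ℝ → Vec ℝ (suc n) → ℝ
next {n} x ps =
  (x /ℝ suc n) *ℝ sumℝ (λ i → fromℕ (σ₂ (suc (toℕ i))) *ℝ lookup ps i)

-- Pₙ(x), …, P₀(x); carrying all earlier values makes the course-of-values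
-- recursion structural.
history : ∀ n → ℝ → Vec ℝ (suc n)
history zero    x = fromℕ 1 ∷ []
history (suc n) x = next x (history n x) ∷ history n x

P : ℕ → ℝ → ℝ
P n x = head (history n x)

private
  sumℝ-cong : ∀ {n} {f g : Fin n → ℝ} → (∀ i → f i ≡ g i) → sumℝ f ≡ sumℝ g
  sumℝ-cong {zero}  f≗g = refl
  sumℝ-cong {suc n} f≗g =
    cong₂ _+ℝ_ (f≗g zero) (sumℝ-cong (λ i → f≗g (suc i)))

  lookup-history : ∀ n x (i : Fin (suc n)) →
    lookup (history n x) i ≡ P (n ℕ.∸ toℕ i) x
  lookup-history zero    x zero    = refl
  lookup-history (suc n) x zero    = refl
  lookup-history (suc n) x (suc i) = lookup-history n x i

P-zero : ∀ x → P 0 x ≡ fromℕ 1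
P-zero x = refl

-- The defining recurrence, with k = i + 1.
P-suc : ∀ n x → P (suc n) x ≡
  (x /ℝ suc n) *ℝ
    sumℝ {suc n} (λ i → fromℕ (σ₂ (suc (toℕ i))) *ℝ P (suc n ℕ.∸ suc (toℕ i)) x)
P-suc n x = cong ((x /ℝ suc n) *ℝ_) (sumℝ-cong {suc n} λ i →
  cong (fromℕ (σ₂ (suc (toℕ i))) *ℝ_) (lookup-history n x i))

{-# OPTIONS --safe #-}

-- Write p(n) for Pₙ(x).  Multiplying p(a) p(b) by a + b and applying the
-- recurrence to each factor gives
--   (a + b) p(a) p(b) = x (p(a) Σ_{k≤b} σ₂(k) p(b−k) + p(b) Σ_{k≤a} σ₂(k) p(a−k)),
-- to be compared with
--   (a + b) p(a+b) = x (Σ_{k≤b} σ₂(k) p(a+b−k) + Σ_{k≤a} σ₂(b+k) p(a−k)).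
-- Let a ≤ b.  By induction the first sums compare termwise, except for the
-- boundedly many terms with a + b − k ≤ 11, where the deficit is at most 100 x.
-- The second sums compare termwise because p(b) ≥ 1110 b³ x while
-- σ₂(b+k) ≤ (2b)³, and this gain outweighs the deficits.
--
-- What remains is a + b ≤ 47 and the growth of p(b) for 24 ≤ b ≤ 47.  These are
-- inequalities between polynomials in z = 100 x − 199 that hold coefficientwise,
-- hence for all z ≥ 0.  Working with x ≥ 1.99 instead of x ≥ 2 allows the real
-- number x to be replaced by its rational approximations, and proving
-- p(a+b) + 1 ≤ p(a) p(b) makes the strict inequality uniform in them.
module Submission where

open import Defs
open import Data.Bool using (Bool; true; T; _∧_)
open import Data.Bool.Properties using (T?; T-∧)
open import Data.Fin using (toℕ)
open import Data.Integer as ℤ using ()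
import Data.Integer.Properties as ℤₚ
open import Data.List using (List; []; _∷_; map; upTo; length)
open import Data.List.Membership.Propositional using (_∈_)
open import Data.List.Membership.Propositional.Properties
  using (∈-map⁺; ∈-map⁻; ∈-filter⁺; ∈-filter⁻; ∈-upTo⁺; ∈-upTo⁻)
open import Data.List.Properties using (length-map; length-filter; length-upTo)
open import Data.List.Relation.Unary.All as All using (All; []; _∷_)
open import Data.List.Relation.Unary.Any using (here; there)
open import Data.Nat as ℕ using (ℕ; zero; suc)
open import Data.Nat.Divisibility using (_∣?_; ∣-refl)
open import Data.Nat.Induction using (<-rec)
open import Data.Nat.ListAction using (sum)
import Data.Nat.Properties as ℕₚ
open import Data.Product using (_×_; _,_; proj₁; proj₂)
open import Data.Rational.Unnormalised as ℚᵘ using (mkℚᵘ; *≡*; *≤*)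
import Data.Rational.Unnormalised.Properties as ℚᵘₚ
open import Data.Sum using ([_,_]′)
open import Data.Unit using (tt)
open import Function using (_∘_)
open import Function.Bundles using (Equivalence)
open import Relation.Binary.PropositionalEquality
open import Relation.Nullary using (Dec; yes; no)
open import Relation.Nullary.Decidable using (_→-dec_; _×-dec_; toWitness)

module _ where

  open import Data.Nat
  open import Data.Nat.Properties
  open import Data.Nat.Solver using (module +-*-Solver)

  -- Powers and elementary bounds for σ₂

  doubled-cube : ∀ b → (b + b) ^ 3 ≡ 8 * b ^ 3
  doubled-cube = solve 1 (λ b → (b :+ b) :^ 3 := con 8 :* (b :^ 3)) refl
    where open +-*-Solver

  doubled-fourth-power : ∀ b → (b + b) ^ 4 ≡ 16 * b * b ^ 3
  doubled-fourth-power = solve 1 (λ b → (b :+ b) :^ 4 := con 16 :* b :* (b :^ 3)) refl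
    where open +-*-Solver

  ∈⇒≤sum : ∀ {n ns} → n ∈ ns → n ≤ sum ns
  ∈⇒≤sum {ns = n ∷ ns} (here refl)  = m≤m+n n (sum ns)
  ∈⇒≤sum {ns = m ∷ ns} (there n∈ns) = ≤-trans (∈⇒≤sum n∈ns) (m≤n+m (sum ns) m)

  sum-≤ : ∀ {B ns} → All (_≤ B) ns → sum ns ≤ length ns * B
  sum-≤ []           = z≤n
  sum-≤ (n≤B ∷ ns≤B) = +-mono-≤ n≤B (sum-≤ ns≤B)

  -- The divisor `suc n` of itself contributes this square.
  σ₂-square : ∀ n → suc n ^ 2 ≤ σ₂ (suc n)
  σ₂-square n = ∈⇒≤sum (∈-map⁺ (_^ 2)
    (∈-filter⁺ (_∣? suc n) (∈-map⁺ suc (∈-upTo⁺ ≤-refl)) ∣-refl))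

  σ₂-positive : ∀ n → 1 ≤ σ₂ (suc n)
  σ₂-positive n = ≤-trans (m^n>0 (suc n) 2) (σ₂-square n)

  -- There are at most n divisors, each at most n. This crude bound suffices because Pₙ eventually
  -- outgrows every multiple of n³.
  σ₂-≤-cube : ∀ n → σ₂ n ≤ n * n ^ 2
  σ₂-≤-cube n = begin
    σ₂ n                                       ≤⟨ sum-≤ (All.tabulate square≤) ⟩
    length (map (_^ 2) (divisors n)) * n ^ 2   ≡⟨ cong (_* n ^ 2) (length-map (_^ 2) (divisors n)) ⟩
    length (divisors n) * n ^ 2                ≤⟨ *-monoˡ-≤ (n ^ 2) (length-filter (_∣? n) (map suc (upTo n))) ⟩
    length (map suc (upTo n)) * n ^ 2          ≡⟨ cong (_* n ^ 2) (trans (length-map suc (upTo n)) (length-upTo n)) ⟩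
    n * n ^ 2                                  ∎
    where
    open ≤-Reasoning
    square≤ : ∀ {s} → s ∈ map (_^ 2) (divisors n) → s ≤ n ^ 2
    square≤ s∈ with ∈-map⁻ (_^ 2) s∈
    ... | d , d∈ , refl with ∈-map⁻ suc (proj₁ (∈-filter⁻ (_∣? n) {xs = map suc (upTo n)} d∈))
    ... | i , i∈ , refl = ^-monoˡ-≤ 2 (∈-upTo⁻ i∈)

  -- Polynomials with natural coefficients, constant term first

  Poly : Set
  Poly = List ℕ

  infix  4 _≤ₚ_
  infixl 6 _⊕_
  infixl 7 _⊛_ _⊗_

  _⊕_ : Poly → Poly → Poly
  []      ⊕ q       = q
  (c ∷ p) ⊕ []      = c ∷ p
  (c ∷ p) ⊕ (e ∷ q) = c + e ∷ p ⊕ q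

  _⊛_ : ℕ → Poly → Poly
  c ⊛ p = map (c *_) p

  _⊗_ : Poly → Poly → Poly
  []      ⊗ q = []
  (c ∷ p) ⊗ q = (c ⊛ q) ⊕ (0 ∷ (p ⊗ q))

  -- Comparing coefficients is sufficient, though not necessary, for an inequality of values at all
  -- z ≥ 0. The Boolean form lets it be decided by evaluation.
  _≤ₚ_ : Poly → Poly → Bool
  []      ≤ₚ q       = true
  (c ∷ p) ≤ₚ []      = (c ≤ᵇ 0) ∧ (p ≤ₚ [])
  (c ∷ p) ≤ₚ (e ∷ q) = (c ≤ᵇ e) ∧ (p ≤ₚ q)

  -- 100 x as a polynomial in z = 100 x − 199.
  100x : Poly
  100x = 199 ∷ 1 ∷ []

  combination : (ℕ → ℕ) → List Poly → Poly
  combination s []       = []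
  combination s (p ∷ ps) = (s 0 ⊛ p) ⊕ combination (s ∘ suc) ps

  -- This is 100ⁿ n!: each step needs a factor 100 for x = (z + 199)/100 and a factor `suc n` for
  -- the division in the recurrence.
  weight : ℕ → ℕ
  weight zero    = 1
  weight (suc n) = 100 * suc n * weight n

  -- A separate function, so that the previous table is shared between its two
  -- uses.
  extend : ℕ → List Poly → List Poly
  extend n ps =
    (100x ⊗ combination (λ i → σ₂ (suc i)) ps) ∷ map ((100 * suc n) ⊛_) ps

  -- weight n · Pₙ, …, weight n · P₀ as polynomials in z: the common weight
  -- clears all denominators.
  table : ℕ → List Poly
  table zero    = (1 ∷ []) ∷ []
  table (suc n) = extend n (table n)

  -- The default is the zero polynomial, so `⟦nth-map-⊛⟧` holds without a bound on the index.
  nth : List Poly → ℕ → Poly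
  nth []       _       = []
  nth (p ∷ _)  zero    = p
  nth (_ ∷ ps) (suc j) = nth ps j

  -- Numerical facts in polynomial form.  The table is an argument, so that the
  -- type checker computes it only once.
  module Tests (W : ℕ) (ps : List Poly) where

    -- The table lists the highest index first, so P₄₇ stands at position 0.
    entry : ℕ → Poly
    entry n = nth ps (47 ∸ n)

    -- With common factors cleared, `Small` encodes p(a+b) ≤ p(a) p(b) + 100 x, scaled by 100 W²,
    -- and `Large` encodes p(a+b) + 1 ≤ p(a) p(b), scaled by W².
    Small Large : ℕ → ℕ → Set
    Small a b = T ((100 * W) ⊛ entry (a + b) ≤ₚ
                   (100 ⊛ (entry a ⊗ entry b)) ⊕ ((100 * (W * W)) ⊛ 100x))
    Large a b = T ((W ⊛ entry (a + b)) ⊕ (W * W ∷ []) ≤ₚ entry a ⊗ entry b)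

    Growth : ℕ → Set
    Growth b = T ((W * (b ^ 3 * 1110)) ⊛ 100x ≤ₚ 100 ⊛ entry b)

    -- Products and sums are symmetric, so only pairs with `suc a ≤ b` are tested. The nested
    -- bounded quantifiers have the shape that `allUpTo?` decides.
    AllSmall AllLarge AllGrowth : Set
    AllSmall  = ∀ {b} → b < 11 → ∀ {a} → a < b → suc a + b ≤ 11 → Small (suc a) b
    AllLarge  = ∀ {b} → b < 47 → ∀ {a} → a < b → 12 ≤ suc a + b → suc a + b ≤ 47 →
      Large (suc a) b
    AllGrowth = ∀ {b} → b < 48 → 24 ≤ b → Growth b

    all? : Dec (AllSmall × AllLarge × AllGrowth)
    all? =
      allUpTo? (λ b → allUpTo? (λ a → (suc a + b ≤? 11) →-dec T? _) b) 11 ×-dec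
      allUpTo? (λ b → allUpTo? (λ a →
        (12 ≤? suc a + b) →-dec ((suc a + b ≤? 47) →-dec T? _)) b) 47 ×-dec
      allUpTo? (λ b → (24 ≤? b) →-dec T? _) 48

  abstract
    all-tests : let open Tests (weight 47) (table 47) in AllSmall × AllLarge × AllGrowth
    all-tests = toWitness {a? = Tests.all? (weight 47) (table 47)} tt

module _ where

  open import Data.Rational
  open import Data.Rational.Properties
  open import Data.Rational.Solver using (module +-*-Solver)
  open +-*-Solver using (solve; con; _:+_; _:*_; _:-_; _:=_)

  -- The embedding of ℕ into ℚ and monotonicity rules

  ι : ℕ → ℚ
  ι n = ℤ.+ n / 1

  toℚᵘ-ι : ∀ n → toℚᵘ (ι n) ℚᵘ.≃ mkℚᵘ (ℤ.+ n) 0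
  toℚᵘ-ι n = toℚᵘ-fromℚᵘ (mkℚᵘ (ℤ.+ n) 0)

  -- In unnormalised rationals no gcd is divided out, so the claim becomes an integer identity.
  ι-+ : ∀ m n → ι (m ℕ.+ n) ≡ ι m + ι n
  ι-+ m n = toℚᵘ-injective (begin-equality
    toℚᵘ (ι (m ℕ.+ n))
      ≃⟨ toℚᵘ-ι (m ℕ.+ n) ⟩
    mkℚᵘ (ℤ.+ (m ℕ.+ n)) 0
      ≃⟨ *≡* (cong (ℤ._* ℤ.+ 1) (trans (ℤₚ.pos-+ m n)
           (sym (cong₂ ℤ._+_ (ℤₚ.*-identityʳ (ℤ.+ m)) (ℤₚ.*-identityʳ (ℤ.+ n)))))) ⟩
    mkℚᵘ (ℤ.+ m) 0 ℚᵘ.+ mkℚᵘ (ℤ.+ n) 0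
      ≃⟨ ℚᵘₚ.+-cong (toℚᵘ-ι m) (toℚᵘ-ι n) ⟨
    toℚᵘ (ι m) ℚᵘ.+ toℚᵘ (ι n)
      ≃⟨ toℚᵘ-homo-+ (ι m) (ι n) ⟨
    toℚᵘ (ι m + ι n) ∎)
    where open ℚᵘₚ.≤-Reasoning

  ι-* : ∀ m n → ι (m ℕ.* n) ≡ ι m * ι n
  ι-* m n = toℚᵘ-injective (begin-equality
    toℚᵘ (ι (m ℕ.* n))                  ≃⟨ toℚᵘ-ι (m ℕ.* n) ⟩
    mkℚᵘ (ℤ.+ (m ℕ.* n)) 0              ≃⟨ *≡* (cong (ℤ._* ℤ.+ 1) (ℤₚ.pos-* m n)) ⟩
    mkℚᵘ (ℤ.+ m) 0 ℚᵘ.* mkℚᵘ (ℤ.+ n) 0  ≃⟨ ℚᵘₚ.*-cong (toℚᵘ-ι m) (toℚᵘ-ι n) ⟨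
    toℚᵘ (ι m) ℚᵘ.* toℚᵘ (ι n)          ≃⟨ toℚᵘ-homo-* (ι m) (ι n) ⟨
    toℚᵘ (ι m * ι n)                    ∎)
    where open ℚᵘₚ.≤-Reasoning

  ι-mono-≤ : ∀ {m n} → m ℕ.≤ n → ι m ≤ ι n
  ι-mono-≤ {m} {n} m≤n = toℚᵘ-cancel-≤ (begin
    toℚᵘ (ι m)      ≃⟨ toℚᵘ-ι m ⟩
    mkℚᵘ (ℤ.+ m) 0  ≤⟨ *≤* (ℤₚ.*-monoʳ-≤-nonNeg (ℤ.+ 1) (ℤ.+≤+ m≤n)) ⟩
    mkℚᵘ (ℤ.+ n) 0  ≃⟨ toℚᵘ-ι n ⟨
    toℚᵘ (ι n)      ∎)
    where open ℚᵘₚ.≤-Reasoning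

  0≤ι : ∀ n → 0ℚ ≤ ι n
  0≤ι n = ι-mono-≤ {0} {n} ℕ.z≤n

  *-monoʳ-≤-0≤ : ∀ {r p q} → 0ℚ ≤ r → p ≤ q → r * p ≤ r * q
  *-monoʳ-≤-0≤ {r} 0≤r = *-monoˡ-≤-nonNeg r {{nonNegative 0≤r}}

  *-monoˡ-≤-0≤ : ∀ {r p q} → 0ℚ ≤ r → p ≤ q → p * r ≤ q * r
  *-monoˡ-≤-0≤ {r} 0≤r = *-monoʳ-≤-nonNeg r {{nonNegative 0≤r}}

  *-mono-≤-0≤ : ∀ {p q r s} → 0ℚ ≤ p → 0ℚ ≤ r → p ≤ q → r ≤ s → p * r ≤ q * s
  *-mono-≤-0≤ {p} {q} 0≤p 0≤r p≤q r≤s =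
    ≤-trans (*-monoˡ-≤-0≤ 0≤r p≤q) (*-monoʳ-≤-0≤ (≤-trans 0≤p p≤q) r≤s)

  0≤+ : ∀ {p q} → 0ℚ ≤ p → 0ℚ ≤ q → 0ℚ ≤ p + q
  0≤+ {p} {q} 0≤p 0≤q = +-mono-≤ {0ℚ} {p} {0ℚ} {q} 0≤p 0≤q

  0≤* : ∀ {p q} → 0ℚ ≤ p → 0ℚ ≤ q → 0ℚ ≤ p * q
  0≤* {p} 0≤p 0≤q = subst (_≤ p * _) (*-zeroʳ p) (*-monoʳ-≤-0≤ 0≤p 0≤q)

  p≤p+q : ∀ {p q} → 0ℚ ≤ q → p ≤ p + q
  p≤p+q {p} 0≤q = subst (_≤ p + _) (+-identityʳ p) (+-monoʳ-≤ p 0≤q)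

  q≤p+q : ∀ {p q} → 0ℚ ≤ p → q ≤ p + q
  q≤p+q {p} {q} 0≤p = subst (_≤ p + q) (+-identityˡ q) (+-monoˡ-≤ q 0≤p)

  ι-positive : ∀ n → 0 ℕ.< n → Positive (ι n)
  ι-positive n 0<n = positive (<-≤-trans (positive⁻¹ 1ℚ) (ι-mono-≤ {1} {n} 0<n))

  ι-cancelˡ-≤ : ∀ n {p q} → 0 ℕ.< n → ι n * p ≤ ι n * q → p ≤ q
  ι-cancelˡ-≤ n 0<n = *-cancelˡ-≤-pos (ι n) {{ι-positive n 0<n}}

  -- Finite sums of rationals

  ∑ : ℕ → (ℕ → ℚ) → ℚ
  ∑ zero    g = 0ℚ
  ∑ (suc n) g = g 0 + ∑ n (g ∘ suc)

  ∑-cong : ∀ n {g h} → (∀ i → i ℕ.< n → g i ≡ h i) → ∑ n g ≡ ∑ n h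
  ∑-cong zero    g≗h = refl
  ∑-cong (suc n) g≗h =
    cong₂ _+_ (g≗h 0 (ℕ.s≤s ℕ.z≤n)) (∑-cong n (λ i i<n → g≗h (suc i) (ℕ.s≤s i<n)))

  ∑-mono-≤ : ∀ n {g h} → (∀ i → i ℕ.< n → g i ≤ h i) → ∑ n g ≤ ∑ n h
  ∑-mono-≤ zero    g≤h = ≤-refl
  ∑-mono-≤ (suc n) g≤h =
    +-mono-≤ (g≤h 0 (ℕ.s≤s ℕ.z≤n)) (∑-mono-≤ n (λ i i<n → g≤h (suc i) (ℕ.s≤s i<n)))

  ∑-≥0 : ∀ n {g} → (∀ i → i ℕ.< n → 0ℚ ≤ g i) → 0ℚ ≤ ∑ n g
  ∑-≥0 zero    0≤g = ≤-refl
  ∑-≥0 (suc n) 0≤g =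
    0≤+ (0≤g 0 (ℕ.s≤s ℕ.z≤n)) (∑-≥0 n (λ i i<n → 0≤g (suc i) (ℕ.s≤s i<n)))

  term≤∑ : ∀ n {g} → (∀ i → i ℕ.< n → 0ℚ ≤ g i) → ∀ i → i ℕ.< n → g i ≤ ∑ n g
  term≤∑ (suc n) 0≤g zero    _   = p≤p+q (∑-≥0 n λ i i<n → 0≤g (suc i) (ℕ.s≤s i<n))
  term≤∑ (suc n) 0≤g (suc i) (ℕ.s≤s i<n) = ≤-trans
    (term≤∑ n (λ j j<n → 0≤g (suc j) (ℕ.s≤s j<n)) i i<n) (q≤p+q (0≤g 0 (ℕ.s≤s ℕ.z≤n)))

  ∑-++ : ∀ m n g → ∑ (m ℕ.+ n) g ≡ ∑ m g + ∑ n (λ i → g (m ℕ.+ i))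
  ∑-++ zero    n g = sym (+-identityˡ _)
  ∑-++ (suc m) n g =
    trans (cong (g 0 +_) (∑-++ m n (g ∘ suc))) (sym (+-assoc (g 0) _ _))

  ∑-distribˡ : ∀ c n g → ∑ n (λ i → c * g i) ≡ c * ∑ n g
  ∑-distribˡ c zero    g = sym (*-zeroʳ c)
  ∑-distribˡ c (suc n) g =
    trans (cong (c * g 0 +_) (∑-distribˡ c n (g ∘ suc))) (sym (*-distribˡ-+ c (g 0) _))

  ∑-+-const : ∀ n g e → ∑ n (λ i → g i + e) ≡ ∑ n g + ι n * e
  ∑-+-const zero    g e = sym (trans (+-identityˡ _) (*-zeroˡ e))
  ∑-+-const (suc n) g e = begin
    (g 0 + e) + ∑ n (λ i → g (suc i) + e)
      ≡⟨ cong ((g 0 + e) +_) (∑-+-const n (g ∘ suc) e) ⟩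
    (g 0 + e) + (∑ n (g ∘ suc) + ι n * e)
      ≡⟨ solve 4 (λ a e s n → (a :+ e) :+ (s :+ n :* e) := (a :+ s) :+ (con 1ℚ :+ n) :* e)
           refl (g 0) e (∑ n (g ∘ suc)) (ι n) ⟩
    (g 0 + ∑ n (g ∘ suc)) + (1ℚ + ι n) * e
      ≡⟨ cong (λ k → (g 0 + ∑ n (g ∘ suc)) + k * e) (ι-+ 1 n) ⟨
    (g 0 + ∑ n (g ∘ suc)) + ι (suc n) * e ∎
    where open ≡-Reasoning

  ∑-last : ∀ n g → ∑ (suc n) g ≡ ∑ n g + g n
  ∑-last zero    g = +-comm (g 0) 0ℚ
  ∑-last (suc n) g =
    trans (cong (λ q → g 0 + q) (∑-last n (g ∘ suc)))
      (sym (+-assoc (g 0) (∑ n (g ∘ suc)) (g (suc n))))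

  -- The whole slack is charged to the last summand, which in the application contains the factor
  -- `f 0 ≡ 1`.
  ∑-mono-≤-slack : ∀ n {g h} e → (∀ i → i ℕ.< n → g i ≤ h i) → g n + e ≤ h n →
    ∑ (suc n) g + e ≤ ∑ (suc n) h
  ∑-mono-≤-slack n {g} {h} e g≤h gn+e≤hn = begin
    ∑ (suc n) g + e    ≡⟨ cong (λ q → q + e) (∑-last n g) ⟩
    ∑ n g + g n + e    ≡⟨ +-assoc (∑ n g) (g n) e ⟩
    ∑ n g + (g n + e)  ≤⟨ +-mono-≤ (∑-mono-≤ n g≤h) gn+e≤hn ⟩
    ∑ n h + h n        ≡⟨ ∑-last n h ⟨
    ∑ (suc n) h        ∎
    where open ≤-Reasoning

  -- Evaluation of polynomials at a nonnegative rational

  module Evaluation (z : ℚ) (0≤z : 0ℚ ≤ z) where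

    ⟦_⟧ : Poly → ℚ
    ⟦ [] ⟧    = 0ℚ
    ⟦ c ∷ p ⟧ = ι c + z * ⟦ p ⟧

    ⟦⊕⟧ : ∀ p q → ⟦ p ⊕ q ⟧ ≡ ⟦ p ⟧ + ⟦ q ⟧
    ⟦⊕⟧ []      q       = sym (+-identityˡ ⟦ q ⟧)
    ⟦⊕⟧ (c ∷ p) []      = sym (+-identityʳ ⟦ c ∷ p ⟧)
    ⟦⊕⟧ (c ∷ p) (e ∷ q) = trans
      (cong₂ (λ u v → u + z * v) (ι-+ c e) (⟦⊕⟧ p q))
      (solve 5 (λ c e z p q → (c :+ e) :+ z :* (p :+ q) := (c :+ z :* p) :+ (e :+ z :* q))
        refl (ι c) (ι e) z ⟦ p ⟧ ⟦ q ⟧)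

    ⟦⊛⟧ : ∀ c p → ⟦ c ⊛ p ⟧ ≡ ι c * ⟦ p ⟧
    ⟦⊛⟧ c []      = sym (*-zeroʳ (ι c))
    ⟦⊛⟧ c (e ∷ p) = trans
      (cong₂ (λ u v → u + z * v) (ι-* c e) (⟦⊛⟧ c p))
      (solve 4 (λ c e z p → c :* e :+ z :* (c :* p) := c :* (e :+ z :* p))
        refl (ι c) (ι e) z ⟦ p ⟧)

    ⟦⊗⟧ : ∀ p q → ⟦ p ⊗ q ⟧ ≡ ⟦ p ⟧ * ⟦ q ⟧
    ⟦⊗⟧ []      q = sym (*-zeroˡ ⟦ q ⟧)
    ⟦⊗⟧ (c ∷ p) q = trans (⟦⊕⟧ (c ⊛ q) (0 ∷ (p ⊗ q))) (trans
      (cong₂ (λ u v → u + (0ℚ + z * v)) (⟦⊛⟧ c q) (⟦⊗⟧ p q))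
      (solve 4 (λ c z p q → c :* q :+ (con 0ℚ :+ z :* (p :* q)) := (c :+ z :* p) :* q)
        refl (ι c) z ⟦ p ⟧ ⟦ q ⟧))

    ⟦⟧-nonNeg : ∀ p → 0ℚ ≤ ⟦ p ⟧
    ⟦⟧-nonNeg []      = ≤-refl
    ⟦⟧-nonNeg (c ∷ p) = 0≤+ (0≤ι c) (0≤* 0≤z (⟦⟧-nonNeg p))

    -- Each coefficient inequality gets multiplied by a power of `z`, which keeps its direction
    -- because of `0≤z`.
    ⟦⟧-mono-≤ : ∀ p q → T (p ≤ₚ q) → ⟦ p ⟧ ≤ ⟦ q ⟧
    ⟦⟧-mono-≤ []      q       _   = ⟦⟧-nonNeg q
    ⟦⟧-mono-≤ (c ∷ p) []      p≤q =
      let c≤0 , p≤[] = Equivalence.to T-∧ p≤q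
      in +-mono-≤ (ι-mono-≤ {c} {0} (ℕₚ.≤ᵇ⇒≤ c 0 c≤0))
           (subst (z * ⟦ p ⟧ ≤_) (*-zeroʳ z) (*-monoʳ-≤-0≤ 0≤z (⟦⟧-mono-≤ p [] p≤[])))
    ⟦⟧-mono-≤ (c ∷ p) (e ∷ q) p≤q =
      let c≤e , p≤q = Equivalence.to T-∧ p≤q
      in +-mono-≤ (ι-mono-≤ {c} {e} (ℕₚ.≤ᵇ⇒≤ c e c≤e)) (*-monoʳ-≤-0≤ 0≤z (⟦⟧-mono-≤ p q p≤q))

    ⟦combination⟧ : ∀ s ps →
      ⟦ combination s ps ⟧ ≡ ∑ (length ps) (λ i → ι (s i) * ⟦ nth ps i ⟧)
    ⟦combination⟧ s []       = refl
    ⟦combination⟧ s (p ∷ ps) = trans (⟦⊕⟧ (s 0 ⊛ p) _)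
      (cong₂ _+_ (⟦⊛⟧ (s 0) p) (⟦combination⟧ (s ∘ suc) ps))

    ⟦nth-map-⊛⟧ : ∀ c ps j → ⟦ nth (map (c ⊛_) ps) j ⟧ ≡ ι c * ⟦ nth ps j ⟧
    ⟦nth-map-⊛⟧ c []       j       = sym (*-zeroʳ (ι c))
    ⟦nth-map-⊛⟧ c (p ∷ ps) zero    = ⟦⊛⟧ c p
    ⟦nth-map-⊛⟧ c (p ∷ ps) (suc j) = ⟦nth-map-⊛⟧ c ps j

  -- Table length, weights and their bounds

  length-table : ∀ n → length (table n) ≡ suc n
  length-table zero    = refl
  length-table (suc n) =
    cong suc (trans (length-map _ (table n)) (length-table n))

  weight-positive : ∀ n → 0 ℕ.< weight n
  weight-positive zero    = ℕ.s≤s ℕ.z≤n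
  weight-positive (suc n) =
    ℕₚ.≤-trans (weight-positive n) (ℕₚ.m≤n*m (weight n) (100 ℕ.* suc n))

  divisor-weight : ℕ → ℚ
  divisor-weight i = ι (σ₂ (suc i))

  -- The left side is at most (2j)⁴ = 16j · j³, and 16j ≤ 16k + 16 ≤ 24k ≤ k². The last step is what
  -- requires k ≥ 24.
  growth-step-ℕ : ∀ k j → 24 ℕ.≤ k → k ℕ.≤ j → j ℕ.≤ suc k →
    (k ℕ.+ j) ℕ.* (k ℕ.+ j) ℕ.^ 3 ℕ.≤ k ℕ.^ 2 ℕ.* j ℕ.^ 3
  growth-step-ℕ k j 24≤k k≤j j≤1+k = begin
    (k ℕ.+ j) ℕ.^ 4          ≤⟨ ℕₚ.^-monoˡ-≤ 4 (ℕₚ.+-monoˡ-≤ j k≤j) ⟩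
    (j ℕ.+ j) ℕ.^ 4          ≡⟨ doubled-fourth-power j ⟩
    16 ℕ.* j ℕ.* j ℕ.^ 3     ≤⟨ ℕₚ.*-monoˡ-≤ (j ℕ.^ 3) 16j≤k² ⟩
    k ℕ.^ 2 ℕ.* j ℕ.^ 3      ∎
    where
    open ℕₚ.≤-Reasoning
    16≤8k : 16 ℕ.≤ 8 ℕ.* k
    16≤8k = ℕₚ.≤-trans (ℕₚ.m≤m+n 16 8) (ℕₚ.≤-trans 24≤k (ℕₚ.m≤n*m k 8))
    16j≤k² : 16 ℕ.* j ℕ.≤ k ℕ.^ 2
    16j≤k² = begin
      16 ℕ.* j              ≤⟨ ℕₚ.*-monoʳ-≤ 16 j≤1+k ⟩
      16 ℕ.* suc k          ≡⟨ ℕₚ.*-suc 16 k ⟩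
      16 ℕ.+ 16 ℕ.* k       ≤⟨ ℕₚ.+-monoˡ-≤ (16 ℕ.* k) 16≤8k ⟩
      8 ℕ.* k ℕ.+ 16 ℕ.* k  ≡⟨ ℕₚ.*-distribʳ-+ k 8 16 ⟨
      24 ℕ.* k              ≤⟨ ℕₚ.*-monoˡ-≤ k 24≤k ⟩
      k ℕ.* k               ≡⟨ cong (k ℕ.*_) (ℕₚ.*-identityʳ k) ⟨
      k ℕ.^ 2               ∎

  divisor-weight-≤ : ∀ {i n} → i ℕ.< n → divisor-weight i ≤ ι (n ℕ.^ 3)
  divisor-weight-≤ {i} {n} i<n =
    ι-mono-≤ {σ₂ (suc i)} {n ℕ.^ 3} (ℕₚ.≤-trans (σ₂-≤-cube (suc i)) (ℕₚ.^-monoˡ-≤ 3 i<n))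

  divisor-weight-≥1 : ∀ i → 1ℚ ≤ divisor-weight i
  divisor-weight-≥1 i = ι-mono-≤ {1} {σ₂ (suc i)} (σ₂-positive i)

  0≤divisor-weight : ∀ i → 0ℚ ≤ divisor-weight i
  0≤divisor-weight i = 0≤ι (σ₂ (suc i))

  -- The recurrence at a rational argument x = (z + 199)/100

  module Recurrence
    (x : ℚ) (f : ℕ → ℚ) (f0≡1 : f 0 ≡ 1ℚ)
    (recurrence : ∀ n → ι n * f n ≡ x * ∑ n (λ i → divisor-weight i * f (n ℕ.∸ suc i)))
    (z : ℚ) (0≤z : 0ℚ ≤ z) (100x≡199+z : ι 100 * x ≡ ι 199 + z)
    where

    open Evaluation z 0≤z

    ⟦100x⟧ : ⟦ 100x ⟧ ≡ ι 100 * x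
    ⟦100x⟧ = trans
      (solve 2 (λ c z → c :+ z :* (con 1ℚ :+ z :* con 0ℚ) := c :+ z) refl (ι 199) z)
      (sym 100x≡199+z)

    -- By induction on n: the head is the recurrence multiplied by `100 · weight n`, and the older
    -- entries only acquire the new factor `100 · suc n`.
    ⟦table⟧ : ∀ n {j} → j ℕ.≤ n → ⟦ nth (table n) j ⟧ ≡ ι (weight n) * f (n ℕ.∸ j)
    ⟦table⟧ zero ℕ.z≤n = trans
      (solve 1 (λ z → con 1ℚ :+ z :* con 0ℚ := con 1ℚ :* con 1ℚ) refl z)
      (cong (1ℚ *_) (sym f0≡1))
    ⟦table⟧ (suc n) {zero} _ = begin
      ⟦ 100x ⊗ combination (λ i → σ₂ (suc i)) (table n) ⟧
        ≡⟨ ⟦⊗⟧ 100x (combination (λ i → σ₂ (suc i)) (table n)) ⟩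
      ⟦ 100x ⟧ * ⟦ combination (λ i → σ₂ (suc i)) (table n) ⟧
        ≡⟨ cong₂ _*_ ⟦100x⟧ (⟦combination⟧ (λ i → σ₂ (suc i)) (table n)) ⟩
      ι 100 * x * ∑ (length (table n)) (λ i → divisor-weight i * ⟦ nth (table n) i ⟧)
        ≡⟨ cong (λ l → ι 100 * x * ∑ l (λ i → divisor-weight i * ⟦ nth (table n) i ⟧)) (length-table n) ⟩
      ι 100 * x * ∑ (suc n) (λ i → divisor-weight i * ⟦ nth (table n) i ⟧)
        ≡⟨ cong (ι 100 * x *_) (∑-cong (suc n) summand) ⟩
      ι 100 * x * ∑ (suc n) (λ i → ι (weight n) * (divisor-weight i * f (n ℕ.∸ i)))
        ≡⟨ cong (ι 100 * x *_)
             (∑-distribˡ (ι (weight n)) (suc n) (λ i → divisor-weight i * f (n ℕ.∸ i))) ⟩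
      ι 100 * x * (ι (weight n) * S)
        ≡⟨ solve 4 (λ c x w s → c :* x :* (w :* s) := c :* w :* (x :* s))
             refl (ι 100) x (ι (weight n)) S ⟩
      ι 100 * ι (weight n) * (x * S)
        ≡⟨ cong (ι 100 * ι (weight n) *_) (recurrence (suc n)) ⟨
      ι 100 * ι (weight n) * (ι (suc n) * f (suc n))
        ≡⟨ solve 4 (λ c w m y → c :* w :* (m :* y) := c :* m :* w :* y)
             refl (ι 100) (ι (weight n)) (ι (suc n)) (f (suc n)) ⟩
      ι 100 * ι (suc n) * ι (weight n) * f (suc n)
        ≡⟨ cong (_* f (suc n)) (ι-weight n) ⟨
      ι (weight (suc n)) * f (suc n) ∎
      where
      open ≡-Reasoning
      S : ℚ
      S = ∑ (suc n) (λ i → divisor-weight i * f (n ℕ.∸ i))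
      ι-weight : ∀ n → ι (weight (suc n)) ≡ ι 100 * ι (suc n) * ι (weight n)
      ι-weight n = trans (ι-* (100 ℕ.* suc n) (weight n)) (cong (_* ι (weight n)) (ι-* 100 (suc n)))
      summand : ∀ i → i ℕ.< suc n →
        divisor-weight i * ⟦ nth (table n) i ⟧ ≡ ι (weight n) * (divisor-weight i * f (n ℕ.∸ i))
      summand i (ℕ.s≤s i≤n) = trans (cong (divisor-weight i *_) (⟦table⟧ n i≤n))
        (solve 3 (λ d w y → d :* (w :* y) := w :* (d :* y)) refl
          (divisor-weight i) (ι (weight n)) (f (n ℕ.∸ i)))
    ⟦table⟧ (suc n) {suc j} (ℕ.s≤s j≤n) = begin
      ⟦ nth (map ((100 ℕ.* suc n) ⊛_) (table n)) j ⟧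
        ≡⟨ ⟦nth-map-⊛⟧ (100 ℕ.* suc n) (table n) j ⟩
      ι (100 ℕ.* suc n) * ⟦ nth (table n) j ⟧
        ≡⟨ cong (ι (100 ℕ.* suc n) *_) (⟦table⟧ n j≤n) ⟩
      ι (100 ℕ.* suc n) * (ι (weight n) * f (n ℕ.∸ j))
        ≡⟨ *-assoc (ι (100 ℕ.* suc n)) (ι (weight n)) (f (n ℕ.∸ j)) ⟨
      ι (100 ℕ.* suc n) * ι (weight n) * f (n ℕ.∸ j)
        ≡⟨ cong (_* f (n ℕ.∸ j)) (ι-* (100 ℕ.* suc n) (weight n)) ⟨
      ι (weight (suc n)) * f (n ℕ.∸ j) ∎
      where open ≡-Reasoning

    -- Generic in the weight and the table, whose concrete values are huge.
    module TestValues (W : ℕ) (0<W : 0 ℕ.< W) (ps : List Poly)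
      (⟦ps⟧ : ∀ {j} → j ℕ.≤ 47 → ⟦ nth ps j ⟧ ≡ ι W * f (47 ℕ.∸ j)) where

      open Tests W ps

      ⟦entry⟧ : ∀ {n} → n ℕ.≤ 47 → ⟦ entry n ⟧ ≡ ι W * f n
      ⟦entry⟧ {n} n≤47 = trans (⟦ps⟧ (ℕₚ.m∸n≤m 47 n)) (cong (λ k → ι W * f k) (ℕₚ.m∸[m∸n]≡n n≤47))

      ⟦entry⊗entry⟧ : ∀ a b → a ℕ.≤ 47 → b ℕ.≤ 47 →
        ⟦ entry a ⊗ entry b ⟧ ≡ ι W * f a * (ι W * f b)
      ⟦entry⊗entry⟧ a b a≤ b≤ =
        trans (⟦⊗⟧ (entry a) (entry b)) (cong₂ _*_ (⟦entry⟧ a≤) (⟦entry⟧ b≤))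

      small-value : ∀ a b → a ℕ.≤ 47 → b ℕ.≤ 47 → a ℕ.+ b ℕ.≤ 47 → Small a b →
        f (a ℕ.+ b) ≤ f a * f b + ι 100 * x
      small-value a b a≤ b≤ ab≤ test =
        ι-cancelˡ-≤ (100 ℕ.* (W ℕ.* W))
          (ℕₚ.*-mono-≤ {1} {100} (ℕ.s≤s ℕ.z≤n) (ℕₚ.*-mono-≤ 0<W 0<W)) (begin
        ι (100 ℕ.* (W ℕ.* W)) * f (a ℕ.+ b)
          ≡⟨ cong (_* f (a ℕ.+ b)) ι-100WW ⟩
        ι 100 * (ι W * ι W) * f (a ℕ.+ b)
          ≡⟨ solve 3 (λ c w y → c :* (w :* w) :* y := c :* w :* (w :* y))
               refl (ι 100) (ι W) (f (a ℕ.+ b)) ⟩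
        ι 100 * ι W * (ι W * f (a ℕ.+ b))
          ≡⟨ cong₂ _*_ (ι-* 100 W) (⟦entry⟧ ab≤) ⟨
        ι (100 ℕ.* W) * ⟦ entry (a ℕ.+ b) ⟧
          ≡⟨ ⟦⊛⟧ (100 ℕ.* W) (entry (a ℕ.+ b)) ⟨
        ⟦ (100 ℕ.* W) ⊛ entry (a ℕ.+ b) ⟧
          ≤⟨ ⟦⟧-mono-≤ ((100 ℕ.* W) ⊛ entry (a ℕ.+ b))
               ((100 ⊛ (entry a ⊗ entry b)) ⊕ ((100 ℕ.* (W ℕ.* W)) ⊛ 100x)) test ⟩
        ⟦ (100 ⊛ (entry a ⊗ entry b)) ⊕ ((100 ℕ.* (W ℕ.* W)) ⊛ 100x) ⟧
          ≡⟨ ⟦⊕⟧ (100 ⊛ (entry a ⊗ entry b)) ((100 ℕ.* (W ℕ.* W)) ⊛ 100x) ⟩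
        ⟦ 100 ⊛ (entry a ⊗ entry b) ⟧ + ⟦ (100 ℕ.* (W ℕ.* W)) ⊛ 100x ⟧
          ≡⟨ cong₂ _+_
               (trans (⟦⊛⟧ 100 (entry a ⊗ entry b)) (cong (ι 100 *_) (⟦entry⊗entry⟧ a b a≤ b≤)))
               (trans (⟦⊛⟧ (100 ℕ.* (W ℕ.* W)) 100x) (cong₂ _*_ ι-100WW ⟦100x⟧)) ⟩
        ι 100 * (ι W * f a * (ι W * f b)) + ι 100 * (ι W * ι W) * (ι 100 * x)
          ≡⟨ solve 5 (λ c w y u x → c :* (w :* y :* (w :* u)) :+ c :* (w :* w) :* (c :* x) :=
               c :* (w :* w) :* (y :* u :+ c :* x)) refl (ι 100) (ι W) (f a) (f b) x ⟩
        ι 100 * (ι W * ι W) * (f a * f b + ι 100 * x)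
          ≡⟨ cong (_* (f a * f b + ι 100 * x)) ι-100WW ⟨
        ι (100 ℕ.* (W ℕ.* W)) * (f a * f b + ι 100 * x) ∎)
        where
        open ≤-Reasoning
        ι-100WW : ι (100 ℕ.* (W ℕ.* W)) ≡ ι 100 * (ι W * ι W)
        ι-100WW = trans (ι-* 100 (W ℕ.* W)) (cong (ι 100 *_) (ι-* W W))

      large-value : ∀ a b → a ℕ.≤ 47 → b ℕ.≤ 47 → a ℕ.+ b ℕ.≤ 47 → Large a b →
        f (a ℕ.+ b) + 1ℚ ≤ f a * f b
      large-value a b a≤ b≤ ab≤ test =
        ι-cancelˡ-≤ (W ℕ.* W) (ℕₚ.*-mono-≤ 0<W 0<W) (begin
        ι (W ℕ.* W) * (f (a ℕ.+ b) + 1ℚ)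
          ≡⟨ cong (_* (f (a ℕ.+ b) + 1ℚ)) (ι-* W W) ⟩
        ι W * ι W * (f (a ℕ.+ b) + 1ℚ)
          ≡⟨ solve 3 (λ w y z → w :* w :* (y :+ con 1ℚ) := w :* (w :* y) :+ (w :* w :+ z :* con 0ℚ))
               refl (ι W) (f (a ℕ.+ b)) z ⟩
        ι W * (ι W * f (a ℕ.+ b)) + (ι W * ι W + z * 0ℚ)
          ≡⟨ cong₂ (λ u v → ι W * u + (v + z * 0ℚ)) (⟦entry⟧ ab≤) (ι-* W W) ⟨
        ι W * ⟦ entry (a ℕ.+ b) ⟧ + ⟦ W ℕ.* W ∷ [] ⟧
          ≡⟨ cong (_+ ⟦ W ℕ.* W ∷ [] ⟧) (⟦⊛⟧ W (entry (a ℕ.+ b))) ⟨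
        ⟦ W ⊛ entry (a ℕ.+ b) ⟧ + ⟦ W ℕ.* W ∷ [] ⟧
          ≡⟨ ⟦⊕⟧ (W ⊛ entry (a ℕ.+ b)) (W ℕ.* W ∷ []) ⟨
        ⟦ (W ⊛ entry (a ℕ.+ b)) ⊕ (W ℕ.* W ∷ []) ⟧
          ≤⟨ ⟦⟧-mono-≤ ((W ⊛ entry (a ℕ.+ b)) ⊕ (W ℕ.* W ∷ [])) (entry a ⊗ entry b) test ⟩
        ⟦ entry a ⊗ entry b ⟧
          ≡⟨ ⟦entry⊗entry⟧ a b a≤ b≤ ⟩
        ι W * f a * (ι W * f b)
          ≡⟨ solve 3 (λ w y u → w :* y :* (w :* u) := w :* w :* (y :* u)) refl (ι W) (f a) (f b) ⟩
        ι W * ι W * (f a * f b)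
          ≡⟨ cong (_* (f a * f b)) (ι-* W W) ⟨
        ι (W ℕ.* W) * (f a * f b) ∎)
        where open ≤-Reasoning

      growth-value : ∀ b → b ℕ.≤ 47 → Growth b → ι (b ℕ.^ 3 ℕ.* 1110) * x ≤ f b
      growth-value b b≤ test =
        ι-cancelˡ-≤ (100 ℕ.* W) (ℕₚ.*-mono-≤ {1} {100} (ℕ.s≤s ℕ.z≤n) 0<W) (begin
        ι (100 ℕ.* W) * (ι K * x)
          ≡⟨ cong (_* (ι K * x)) (ι-* 100 W) ⟩
        ι 100 * ι W * (ι K * x)
          ≡⟨ solve 4 (λ c w k x → c :* w :* (k :* x) := w :* k :* (c :* x))
               refl (ι 100) (ι W) (ι K) x ⟩
        ι W * ι K * (ι 100 * x)
          ≡⟨ cong₂ _*_ (ι-* W K) ⟦100x⟧ ⟨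
        ι (W ℕ.* K) * ⟦ 100x ⟧
          ≡⟨ ⟦⊛⟧ (W ℕ.* K) 100x ⟨
        ⟦ (W ℕ.* K) ⊛ 100x ⟧
          ≤⟨ ⟦⟧-mono-≤ ((W ℕ.* K) ⊛ 100x) (100 ⊛ entry b) test ⟩
        ⟦ 100 ⊛ entry b ⟧
          ≡⟨ trans (⟦⊛⟧ 100 (entry b)) (cong (ι 100 *_) (⟦entry⟧ b≤)) ⟩
        ι 100 * (ι W * f b)
          ≡⟨ *-assoc (ι 100) (ι W) (f b) ⟨
        ι 100 * ι W * f b
          ≡⟨ cong (_* f b) (ι-* 100 W) ⟨
        ι (100 ℕ.* W) * f b ∎)
        where
        open ≤-Reasoning
        K : ℕ
        K = b ℕ.^ 3 ℕ.* 1110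

    open TestValues (weight 47) (weight-positive 47) (table 47) (⟦table⟧ 47)

    small-sum : ∀ {a b} → a ℕ.< b → suc a ℕ.+ b ℕ.≤ 11 →
      f (suc a ℕ.+ b) ≤ f (suc a) * f b + ι 100 * x
    small-sum {a} {b} a<b ≤11 = small-value (suc a) b
      (ℕₚ.m+n≤o⇒m≤o (suc a) ≤47) (ℕₚ.m+n≤o⇒n≤o (suc a) ≤47) ≤47
      (proj₁ all-tests (ℕₚ.m+n≤o⇒n≤o a (ℕₚ.≤-trans (ℕₚ.≤-reflexive (ℕₚ.+-suc a b)) ≤11)) a<b ≤11)
      where
      ≤47 : suc a ℕ.+ b ℕ.≤ 47
      ≤47 = ℕₚ.≤-trans ≤11 (ℕₚ.m≤m+n 11 36)

    medium-sum : ∀ {a b} → a ℕ.< b → 12 ℕ.≤ suc a ℕ.+ b → suc a ℕ.+ b ℕ.≤ 47 →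
      f (suc a ℕ.+ b) + 1ℚ ≤ f (suc a) * f b
    medium-sum {a} {b} a<b ≥12 ≤47 = large-value (suc a) b
      (ℕₚ.m+n≤o⇒m≤o (suc a) ≤47) (ℕₚ.m+n≤o⇒n≤o (suc a) ≤47) ≤47
      (proj₁ (proj₂ all-tests)
        (ℕₚ.m+n≤o⇒n≤o a (ℕₚ.≤-trans (ℕₚ.≤-reflexive (ℕₚ.+-suc a b)) ≤47)) a<b ≥12 ≤47)

    growth-base : ∀ {b} → 24 ℕ.≤ b → b ℕ.< 48 → ι (b ℕ.^ 3 ℕ.* 1110) * x ≤ f b
    growth-base {b} ≥24 (ℕ.s≤s ≤47) = growth-value b ≤47 (proj₂ (proj₂ all-tests) (ℕ.s≤s ≤47) ≥24)

    -- Nonnegativity and growth of the sequence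

    1≤x : 1ℚ ≤ x
    1≤x = ι-cancelˡ-≤ 100 ℕ.z<s (begin
      ι 100 * 1ℚ  ≤⟨ ι-mono-≤ {100} {199} (ℕₚ.m≤m+n 100 99) ⟩
      ι 199       ≤⟨ p≤p+q 0≤z ⟩
      ι 199 + z   ≡⟨ 100x≡199+z ⟨
      ι 100 * x   ∎)
      where open ≤-Reasoning

    0≤x : 0ℚ ≤ x
    0≤x = ≤-trans (0≤ι 1) 1≤x

    p≤p*x : ∀ {p} → 0ℚ ≤ p → p ≤ p * x
    p≤p*x {p} 0≤p = subst (_≤ p * x) (*-identityʳ p) (*-monoʳ-≤-0≤ 0≤p 1≤x)

    f-nonNeg : ∀ n → 0ℚ ≤ f n
    f-nonNeg = <-rec _ λ
      { zero    _  → subst (0ℚ ≤_) (sym f0≡1) (0≤ι 1)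
      ; (suc n) ih → ι-cancelˡ-≤ (suc n) ℕ.z<s (begin
          ι (suc n) * 0ℚ       ≡⟨ *-zeroʳ (ι (suc n)) ⟩
          0ℚ                   ≤⟨ 0≤* 0≤x (∑-≥0 (suc n) λ i _ →
                                    0≤* (0≤divisor-weight i) (ih (ℕ.s≤s (ℕₚ.m∸n≤m n i)))) ⟩
          x * ∑ (suc n) (λ i → divisor-weight i * f (n ℕ.∸ i))
                               ≡⟨ recurrence (suc n) ⟨
          ι (suc n) * f (suc n) ∎)
      }
      where open ≤-Reasoning

    -- A single summand of the recurrence at k + j is already large enough.
    growth-step : ∀ k j → 24 ℕ.≤ k → k ℕ.≤ j → j ℕ.≤ suc k →
      ι (j ℕ.^ 3 ℕ.* 1110) * x ≤ f j → ι ((k ℕ.+ j) ℕ.^ 3 ℕ.* 1110) * x ≤ f (k ℕ.+ j)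
    growth-step (suc k) j 24≤k k≤j j≤1+k growth-j = ι-cancelˡ-≤ b ℕ.z<s (begin
      ι b * (ι (b ℕ.^ 3 ℕ.* 1110) * x)
        ≡⟨ trans (cong (_* x) (ι-* b (b ℕ.^ 3 ℕ.* 1110))) (*-assoc (ι b) (ι (b ℕ.^ 3 ℕ.* 1110)) x) ⟨
      ι (b ℕ.* (b ℕ.^ 3 ℕ.* 1110)) * x
        ≤⟨ *-monoˡ-≤-0≤ 0≤x (ι-mono-≤ {b ℕ.* (b ℕ.^ 3 ℕ.* 1110)} {suc k ℕ.^ 2 ℕ.* K} growth-step-K) ⟩
      ι (suc k ℕ.^ 2 ℕ.* K) * x
        -- The recurrence brings one factor `x` and `growth-j` another, so the second one is
        -- supplied here from x ≥ 1.
        ≤⟨ p≤p*x (0≤* (0≤ι (suc k ℕ.^ 2 ℕ.* K)) 0≤x) ⟩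
      ι (suc k ℕ.^ 2 ℕ.* K) * x * x
        ≡⟨ cong (λ q → q * x * x) (ι-* (suc k ℕ.^ 2) K) ⟩
      ι (suc k ℕ.^ 2) * ι K * x * x
        ≡⟨ solve 3 (λ p q x → p :* q :* x :* x := x :* (p :* (q :* x)))
             refl (ι (suc k ℕ.^ 2)) (ι K) x ⟩
      x * (ι (suc k ℕ.^ 2) * (ι K * x))
        ≤⟨ *-monoʳ-≤-0≤ 0≤x (*-mono-≤-0≤ (0≤ι (suc k ℕ.^ 2)) (0≤* (0≤ι K) 0≤x)
             (ι-mono-≤ {suc k ℕ.^ 2} {σ₂ (suc k)} (σ₂-square k)) growth-j) ⟩
      x * (divisor-weight k * f j)
        ≡⟨ cong (λ c → x * (divisor-weight k * f c)) (ℕₚ.m+n∸m≡n k j) ⟨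
      x * (divisor-weight k * f (b ℕ.∸ suc k))
        ≤⟨ *-monoʳ-≤-0≤ 0≤x (term≤∑ b {λ i → divisor-weight i * f (b ℕ.∸ suc i)}
             (λ i _ → 0≤* (0≤divisor-weight i) (f-nonNeg (b ℕ.∸ suc i))) k (ℕ.s≤s (ℕₚ.m≤m+n k j))) ⟩
      x * ∑ b (λ i → divisor-weight i * f (b ℕ.∸ suc i))
        ≡⟨ recurrence b ⟨
      ι b * f b ∎)
      where
      open ≤-Reasoning
      b K : ℕ
      b = suc k ℕ.+ j
      K = j ℕ.^ 3 ℕ.* 1110
      growth-step-K : b ℕ.* (b ℕ.^ 3 ℕ.* 1110) ℕ.≤ suc k ℕ.^ 2 ℕ.* K
      growth-step-K = subst₂ ℕ._≤_
        (ℕₚ.*-assoc b (b ℕ.^ 3) 1110) (ℕₚ.*-assoc (suc k ℕ.^ 2) (j ℕ.^ 3) 1110)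
        (ℕₚ.*-monoˡ-≤ 1110 (growth-step-ℕ (suc k) j 24≤k k≤j j≤1+k))

    -- Below 48 this is the finite check. From 48 on, both halves of b are at least 24, and
    -- `growth-step` combines them.
    growth : ∀ b → 24 ℕ.≤ b → ι (b ℕ.^ 3 ℕ.* 1110) * x ≤ f b
    growth = <-rec (λ b → 24 ℕ.≤ b → ι (b ℕ.^ 3 ℕ.* 1110) * x ≤ f b) go
      where
      go : ∀ b → (∀ {c} → c ℕ.< b → 24 ℕ.≤ c → ι (c ℕ.^ 3 ℕ.* 1110) * x ≤ f c) →
        24 ℕ.≤ b → ι (b ℕ.^ 3 ℕ.* 1110) * x ≤ f b
      go b ih 24≤b with b ℕ.<? 48
      ... | yes b<48 = growth-base 24≤b b<48
      ... | no  b≮48 = subst (λ c → ι (c ℕ.^ 3 ℕ.* 1110) * x ≤ f c) (ℕₚ.⌊n/2⌋+⌈n/2⌉≡n b)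
        (growth-step ℕ.⌊ b /2⌋ ℕ.⌈ b /2⌉ 24≤k (ℕₚ.⌊n/2⌋≤⌈n/2⌉ b) (j≤1+k b)
          (ih j<b (ℕₚ.≤-trans 24≤k (ℕₚ.⌊n/2⌋≤⌈n/2⌉ b))))
        where
        24≤k : 24 ℕ.≤ ℕ.⌊ b /2⌋
        24≤k = ℕₚ.⌊n/2⌋-mono (ℕₚ.≮⇒≥ b≮48)
        j≤1+k : ∀ b → ℕ.⌈ b /2⌉ ℕ.≤ suc ℕ.⌊ b /2⌋
        j≤1+k zero          = ℕ.z≤n
        j≤1+k (suc zero)    = ℕₚ.≤-refl
        j≤1+k (suc (suc b)) = ℕ.s≤s (j≤1+k b)
        j<b : ℕ.⌈ b /2⌉ ℕ.< b
        j<b = subst (ℕ.⌈ b /2⌉ ℕ.<_) (ℕₚ.⌊n/2⌋+⌈n/2⌉≡n b)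
          (ℕₚ.+-monoˡ-≤ ℕ.⌈ b /2⌉ (ℕₚ.≤-trans (ℕ.s≤s ℕ.z≤n) 24≤k))

    -- The induction step for a large sum

    Gap : ℕ → ℕ → Set
    Gap a b = f (a ℕ.+ b) + 1ℚ ≤ f a * f b

    Gap-sym : ∀ a b → Gap a b → Gap b a
    Gap-sym a b = subst₂ (λ n q → f n + 1ℚ ≤ q) (ℕₚ.+-comm a b) (*-comm (f a) (f b))

    small-sum-sym : ∀ a b → suc a ℕ.+ suc b ℕ.≤ 11 →
      f (suc a ℕ.+ suc b) ≤ f (suc a) * f (suc b) + ι 100 * x
    small-sum-sym a b ≤11 = [ (λ a≤b → small-sum a≤b ≤11)
      , (λ b≤a → subst₂ (λ n q → f n ≤ q + ι 100 * x)
          (ℕₚ.+-comm (suc b) (suc a)) (*-comm (f (suc b)) (f (suc a)))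
          (small-sum b≤a (subst (ℕ._≤ 11) (ℕₚ.+-comm (suc a) (suc b)) ≤11)))
      ]′ (ℕₚ.≤-total (suc a) (suc b))

    module Step (a b : ℕ) (a≤b : suc a ℕ.≤ b) (24≤b : 24 ℕ.≤ b)
      (ih : ∀ c d → 12 ℕ.≤ suc c ℕ.+ suc d → suc c ℕ.+ suc d ℕ.< b ℕ.+ suc a →
            Gap (suc c) (suc d))
      where

      n m : ℕ
      n = b ℕ.+ suc a
      -- For `i < m` the remaining index `b ∸ suc i` is at least 11, so adding `suc a` reaches 12
      -- and the induction hypothesis applies. The last 11 summands use the weaker `approximate`.
      m = b ℕ.∸ 11

      11≤b : 11 ℕ.≤ b
      11≤b = ℕₚ.≤-trans (ℕₚ.m≤m+n 11 13) 24≤b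

      m+11≡b : m ℕ.+ 11 ≡ b
      m+11≡b = ℕₚ.m∸n+n≡m 11≤b

      B error : ℚ
      B     = ι (b ℕ.^ 3)
      -- A deficit of 100 x is multiplied by a weight, and the weights with i < b are at most b³.
      error = B * (ι 100 * x)

      0≤B : 0ℚ ≤ B
      0≤B = 0≤ι (b ℕ.^ 3)

      0≤100x : 0ℚ ≤ ι 100 * x
      0≤100x = 0≤* (0≤ι 100) 0≤x

      -- The summands of the recurrences at n, at b (multiplied by f (suc a)) and
      -- at suc a (multiplied by f b).
      t u v : ℕ → ℚ
      t i = divisor-weight i * f (n ℕ.∸ suc i)
      u i = f (suc a) * (divisor-weight i * f (b ℕ.∸ suc i))
      v i = f b * (divisor-weight i * f (a ℕ.∸ i))

      exact : ∀ c → 12 ℕ.≤ suc c ℕ.+ suc a → suc c ℕ.+ suc a ℕ.< n →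
        f (suc c ℕ.+ suc a) ≤ f (suc a) * f (suc c)
      exact c ≥12 <n = begin
        f (suc c ℕ.+ suc a)       ≤⟨ p≤p+q (0≤ι 1) ⟩
        f (suc c ℕ.+ suc a) + 1ℚ  ≤⟨ ih c a ≥12 <n ⟩
        f (suc c) * f (suc a)     ≡⟨ *-comm (f (suc c)) (f (suc a)) ⟩
        f (suc a) * f (suc c)     ∎
        where open ≤-Reasoning

      exact-≥11 : ∀ c → 11 ℕ.≤ c → c ℕ.+ suc a ℕ.< n → f (c ℕ.+ suc a) ≤ f (suc a) * f c
      exact-≥11 (suc c) 11≤c = exact c (ℕₚ.+-mono-≤ {11} {suc c} {1} {suc a} 11≤c ℕ.z<s)

      -- Three cases: `c = 0` is immediate from `f 0 ≡ 1`, sums of at least 12 follow from the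
      -- induction hypothesis, and sums of at most 11 from the finite check.
      approximate : ∀ c → c ℕ.+ suc a ℕ.< n → f (c ℕ.+ suc a) ≤ f (suc a) * f c + ι 100 * x
      approximate zero    _  = ≤-trans
        (≤-reflexive (trans (sym (*-identityʳ (f (suc a)))) (cong (f (suc a) *_) (sym f0≡1))))
        (p≤p+q 0≤100x)
      approximate (suc c) <n with 12 ℕ.≤? suc c ℕ.+ suc a
      ... | yes ≥12 = ≤-trans (exact c ≥12 <n) (p≤p+q 0≤100x)
      ... | no  ≱12 = subst (λ q → f (suc c ℕ.+ suc a) ≤ q + ι 100 * x)
        (*-comm (f (suc c)) (f (suc a))) (small-sum-sym c a (ℕₚ.≤-pred (ℕₚ.≰⇒> ≱12)))

      index : ∀ {i} → i ℕ.< b → n ℕ.∸ suc i ≡ (b ℕ.∸ suc i) ℕ.+ suc a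
      index i<b = ℕₚ.+-∸-comm (suc a) i<b

      index<n : ∀ {i} → i ℕ.< b → (b ℕ.∸ suc i) ℕ.+ suc a ℕ.< n
      index<n {i} i<b = ℕₚ.+-monoˡ-< (suc a) (ℕₚ.∸-monoʳ-< {b} {suc i} {0} (ℕ.s≤s ℕ.z≤n) i<b)

      t≤u : ∀ i → i ℕ.< m → t i ≤ u i
      t≤u i i<m = begin
        divisor-weight i * f (n ℕ.∸ suc i)
          ≡⟨ cong (λ c → divisor-weight i * f c) (index i<b) ⟩
        divisor-weight i * f ((b ℕ.∸ suc i) ℕ.+ suc a)
          ≤⟨ *-monoʳ-≤-0≤ (0≤divisor-weight i) (exact-≥11 (b ℕ.∸ suc i) 11≤c (index<n i<b)) ⟩
        divisor-weight i * (f (suc a) * f (b ℕ.∸ suc i))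
          ≡⟨ solve 3 (λ d p q → d :* (p :* q) := p :* (d :* q)) refl
               (divisor-weight i) (f (suc a)) (f (b ℕ.∸ suc i)) ⟩
        u i ∎
        where
        open ≤-Reasoning
        i<b : i ℕ.< b
        i<b = ℕₚ.≤-trans i<m (ℕₚ.m∸n≤m b 11)
        11≤c : 11 ℕ.≤ b ℕ.∸ suc i
        11≤c = subst (ℕ._≤ b ℕ.∸ suc i) (ℕₚ.m∸[m∸n]≡n 11≤b) (ℕₚ.∸-monoʳ-≤ b i<m)

      t≤u+error : ∀ i → i ℕ.< b → t i ≤ u i + error
      t≤u+error i i<b = begin
        divisor-weight i * f (n ℕ.∸ suc i)
          ≡⟨ cong (λ c → divisor-weight i * f c) (index i<b) ⟩
        divisor-weight i * f ((b ℕ.∸ suc i) ℕ.+ suc a)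
          ≤⟨ *-monoʳ-≤-0≤ (0≤divisor-weight i) (approximate (b ℕ.∸ suc i) (index<n i<b)) ⟩
        divisor-weight i * (f (suc a) * f (b ℕ.∸ suc i) + ι 100 * x)
          ≡⟨ solve 4 (λ d p q e → d :* (p :* q :+ e) := p :* (d :* q) :+ d :* e)
               refl (divisor-weight i) (f (suc a)) (f (b ℕ.∸ suc i)) (ι 100 * x) ⟩
        u i + divisor-weight i * (ι 100 * x)
          ≤⟨ +-monoʳ-≤ (u i) (*-monoˡ-≤-0≤ 0≤100x (divisor-weight-≤ i<b)) ⟩
        u i + error ∎
        where open ≤-Reasoning

      ∑t≤∑u : ∑ b t ≤ ∑ b u + ι 11 * error
      ∑t≤∑u = begin
        ∑ b t
          ≡⟨ trans (cong (λ l → ∑ l t) (sym m+11≡b)) (∑-++ m 11 t) ⟩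
        ∑ m t + ∑ 11 (λ i → t (m ℕ.+ i))
          ≤⟨ +-mono-≤ (∑-mono-≤ m t≤u)
               (∑-mono-≤ 11 λ i i<11 → t≤u+error (m ℕ.+ i)
                 (subst (m ℕ.+ i ℕ.<_) m+11≡b (ℕₚ.+-monoʳ-< m i<11))) ⟩
        ∑ m u + ∑ 11 (λ i → u (m ℕ.+ i) + error)
          ≡⟨ cong (λ q → ∑ m u + q) (∑-+-const 11 (λ i → u (m ℕ.+ i)) error) ⟩
        ∑ m u + (∑ 11 (λ i → u (m ℕ.+ i)) + ι 11 * error)
          ≡⟨ +-assoc (∑ m u) (∑ 11 (λ i → u (m ℕ.+ i))) (ι 11 * error) ⟨
        ∑ m u + ∑ 11 (λ i → u (m ℕ.+ i)) + ι 11 * error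
          ≡⟨ cong (λ q → q + ι 11 * error) (∑-++ m 11 u) ⟨
        ∑ (m ℕ.+ 11) u + ι 11 * error
          ≡⟨ cong (λ l → ∑ l u + ι 11 * error) m+11≡b ⟩
        ∑ b u + ι 11 * error ∎
        where open ≤-Reasoning

      1110Bx≤fb : ι 1110 * B * x ≤ f b
      1110Bx≤fb = subst (λ q → q * x ≤ f b) (trans (ι-* (b ℕ.^ 3) 1110) (*-comm B (ι 1110)))
        (growth b 24≤b)

      -- Since `suc a ≤ b`, the argument b + i + 1 of σ₂ is at most 2b.
      shifted-weight-≤ : ∀ i → i ℕ.≤ a → divisor-weight (b ℕ.+ i) ≤ ι 8 * B
      shifted-weight-≤ i i≤a = subst (divisor-weight (b ℕ.+ i) ≤_)
        (trans (cong ι (doubled-cube b)) (ι-* 8 (b ℕ.^ 3)))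
        (divisor-weight-≤ (ℕₚ.+-monoʳ-< b (ℕₚ.≤-trans (ℕ.s≤s i≤a) a≤b)))

      n≤2B : ι n ≤ ι 2 * B
      n≤2B = subst (ι n ≤_) (ι-* 2 (b ℕ.^ 3)) (ι-mono-≤ {n} {2 ℕ.* b ℕ.^ 3} (begin
        b ℕ.+ suc a                        ≤⟨ ℕₚ.+-monoʳ-≤ b a≤b ⟩
        b ℕ.+ b                            ≡⟨ cong (b ℕ.+_) (ℕₚ.+-identityʳ b) ⟨
        2 ℕ.* b                            ≤⟨ ℕₚ.*-monoʳ-≤ 2 b≤b³ ⟩
        2 ℕ.* b ℕ.^ 3                      ∎))
        where
        open ℕₚ.≤-Reasoning
        instance
          b≢0 : ℕ.NonZero b
          b≢0 = ℕ.>-nonZero (ℕₚ.≤-trans (ℕ.s≤s ℕ.z≤n) 24≤b)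
        b≤b³ : b ℕ.≤ b ℕ.^ 3
        b≤b³ = ℕₚ.m≤m*n b (b ℕ.^ 2) {{ℕₚ.m^n≢0 b 2}}

      -- This is the origin of the constant: 1110 = 8 + 11 · 100 + 2, for a shifted weight, the
      -- eleven errors and the bound on `ι n`. The terms without `x` are enlarged using x ≥ 1.
      1110Bx-split : ι 8 * B + (ι 11 * error + ι 2 * B) ≤ ι 1110 * B * x
      1110Bx-split = begin
        ι 8 * B + (ι 11 * error + ι 2 * B)
          ≤⟨ +-mono-≤ (p≤p*x (0≤* (0≤ι 8) 0≤B))
               (+-monoʳ-≤ (ι 11 * error) (p≤p*x (0≤* (0≤ι 2) 0≤B))) ⟩
        ι 8 * B * x + (ι 11 * error + ι 2 * B * x)
          ≡⟨ solve 2 (λ B x → con (ι 8) :* B :* x :+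
               (con (ι 11) :* (B :* (con (ι 100) :* x)) :+ con (ι 2) :* B :* x) :=
               con (ι 1110) :* B :* x) refl B x ⟩
        ι 1110 * B * x ∎
        where open ≤-Reasoning

      fb≤fb*weight : ∀ i → f b ≤ f b * divisor-weight i
      fb≤fb*weight i = subst (_≤ f b * divisor-weight i) (*-identityʳ (f b))
        (*-monoʳ-≤-0≤ (f-nonNeg b) (divisor-weight-≥1 i))

      t-shift : ∀ i → t (b ℕ.+ i) ≡ divisor-weight (b ℕ.+ i) * f (a ℕ.∸ i)
      t-shift i = cong (λ c → divisor-weight (b ℕ.+ i) * f c)
        (trans (cong (n ℕ.∸_) (sym (ℕₚ.+-suc b i))) (ℕₚ.[m+n]∸[m+o]≡n∸o b (suc a) (suc i)))

      8B≤fb : ι 8 * B ≤ f b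
      8B≤fb = ≤-trans (p≤p+q (0≤+ (0≤* (0≤ι 11) (0≤* 0≤B 0≤100x)) (0≤* (0≤ι 2) 0≤B)))
        (≤-trans 1110Bx-split 1110Bx≤fb)

      -- The factor `f b` alone exceeds every shifted weight, and `divisor-weight i ≥ 1` only helps.
      t≤v : ∀ i → i ℕ.< a → t (b ℕ.+ i) ≤ v i
      t≤v i i<a = begin
        t (b ℕ.+ i)                                ≡⟨ t-shift i ⟩
        divisor-weight (b ℕ.+ i) * f (a ℕ.∸ i)     ≤⟨ *-monoˡ-≤-0≤ (f-nonNeg (a ℕ.∸ i))
          (≤-trans (shifted-weight-≤ i (ℕₚ.<⇒≤ i<a)) (≤-trans 8B≤fb (fb≤fb*weight i))) ⟩
        f b * divisor-weight i * f (a ℕ.∸ i)       ≡⟨ *-assoc (f b) (divisor-weight i) (f (a ℕ.∸ i)) ⟩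
        v i                                        ∎
        where open ≤-Reasoning

      -- It collects the eleven errors of the first sum and the term `ι n` that becomes the 1 in
      -- `Gap` after division by n.
      slack : ℚ
      slack = ι 11 * error + ι n

      -- At `i = a` the remaining factor is `f 0 ≡ 1`, so weight and slack together are compared
      -- with `f b` directly.
      t+slack≤v : t (b ℕ.+ a) + slack ≤ v a
      t+slack≤v = begin
        t (b ℕ.+ a) + slack
          ≡⟨ cong (λ q → q + slack) (t-shift a) ⟩
        divisor-weight (b ℕ.+ a) * f (a ℕ.∸ a) + slack
          ≡⟨ cong (λ q → divisor-weight (b ℕ.+ a) * q + slack) fa∸a≡1 ⟩
        divisor-weight (b ℕ.+ a) * 1ℚ + slack
          ≡⟨ cong (λ q → q + slack) (*-identityʳ (divisor-weight (b ℕ.+ a))) ⟩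
        divisor-weight (b ℕ.+ a) + (ι 11 * error + ι n)
          ≤⟨ +-mono-≤ (shifted-weight-≤ a ℕₚ.≤-refl) (+-monoʳ-≤ (ι 11 * error) n≤2B) ⟩
        ι 8 * B + (ι 11 * error + ι 2 * B)
          ≤⟨ ≤-trans 1110Bx-split 1110Bx≤fb ⟩
        f b
          ≤⟨ fb≤fb*weight a ⟩
        f b * divisor-weight a
          ≡⟨ cong (f b *_) (trans (cong (divisor-weight a *_) fa∸a≡1) (*-identityʳ (divisor-weight a))) ⟨
        v a ∎
        where
        open ≤-Reasoning
        fa∸a≡1 : f (a ℕ.∸ a) ≡ 1ℚ
        fa∸a≡1 = trans (cong f (ℕₚ.n∸n≡0 a)) f0≡1

      S : ℕ → ℚ
      S c = ∑ c (λ i → divisor-weight i * f (c ℕ.∸ suc i))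

      S-bound : S n + ι n ≤ f (suc a) * S b + f b * S (suc a)
      S-bound = begin
        ∑ n t + ι n
          ≡⟨ cong (λ q → q + ι n) (∑-++ b (suc a) t) ⟩
        ∑ b t + ∑ (suc a) (λ i → t (b ℕ.+ i)) + ι n
          ≤⟨ +-monoˡ-≤ (ι n) (+-monoˡ-≤ (∑ (suc a) (λ i → t (b ℕ.+ i))) ∑t≤∑u) ⟩
        ∑ b u + ι 11 * error + ∑ (suc a) (λ i → t (b ℕ.+ i)) + ι n
          ≡⟨ solve 4 (λ p e q n → p :+ e :+ q :+ n := p :+ (q :+ (e :+ n))) refl
               (∑ b u) (ι 11 * error) (∑ (suc a) (λ i → t (b ℕ.+ i))) (ι n) ⟩
        ∑ b u + (∑ (suc a) (λ i → t (b ℕ.+ i)) + slack)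
          ≤⟨ +-monoʳ-≤ (∑ b u) (∑-mono-≤-slack a slack t≤v t+slack≤v) ⟩
        ∑ b u + ∑ (suc a) v
          ≡⟨ cong₂ _+_ (∑-distribˡ (f (suc a)) b (λ i → divisor-weight i * f (b ℕ.∸ suc i)))
               (∑-distribˡ (f b) (suc a) (λ i → divisor-weight i * f (a ℕ.∸ i))) ⟩
        f (suc a) * S b + f b * S (suc a) ∎
        where open ≤-Reasoning

      gap : Gap b (suc a)
      gap = ι-cancelˡ-≤ n (ℕₚ.<-≤-trans ℕ.z<s (ℕₚ.m≤n+m (suc a) b)) (begin
        ι n * (f n + 1ℚ)
          ≡⟨ trans (*-distribˡ-+ (ι n) (f n) 1ℚ) (cong₂ _+_ (recurrence n) (*-identityʳ (ι n))) ⟩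
        x * S n + ι n
          -- Enlarging n to n x allows `x` to be factored out before `S-bound` is applied.
          ≤⟨ +-monoʳ-≤ (x * S n) (p≤p*x (0≤ι n)) ⟩
        x * S n + ι n * x
          ≡⟨ solve 3 (λ x s n → x :* s :+ n :* x := x :* (s :+ n)) refl x (S n) (ι n) ⟩
        x * (S n + ι n)
          ≤⟨ *-monoʳ-≤-0≤ 0≤x S-bound ⟩
        x * (f (suc a) * S b + f b * S (suc a))
          ≡⟨ solve 5 (λ x p s q r → x :* (p :* s :+ q :* r) := p :* (x :* s) :+ q :* (x :* r)) refl
               x (f (suc a)) (S b) (f b) (S (suc a)) ⟩
        f (suc a) * (x * S b) + f b * (x * S (suc a))
          ≡⟨ cong₂ (λ p q → f (suc a) * p + f b * q) (recurrence b) (recurrence (suc a)) ⟨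
        f (suc a) * (ι b * f b) + f b * (ι (suc a) * f (suc a))
          ≡⟨ solve 4 (λ p q k l → p :* (k :* q) :+ q :* (l :* p) := (k :+ l) :* (q :* p)) refl
               (f (suc a)) (f b) (ι b) (ι (suc a)) ⟩
        (ι b + ι (suc a)) * (f b * f (suc a))
          ≡⟨ cong (_* (f b * f (suc a))) (ι-+ b (suc a)) ⟨
        ι n * (f b * f (suc a)) ∎)
        where open ≤-Reasoning

    -- Strong induction on the sum of the two indices

    GapsAt : ℕ → Set
    GapsAt n = ∀ a b → 12 ℕ.≤ suc a ℕ.+ suc b → suc a ℕ.+ suc b ≡ n → Gap (suc a) (suc b)

    ordered-gap : ∀ a b → a ℕ.≤ b → 12 ℕ.≤ suc a ℕ.+ suc b →
      (∀ {m} → m ℕ.< suc a ℕ.+ suc b → GapsAt m) → Gap (suc a) (suc b)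
    ordered-gap a b a≤b ≥12 ih with suc a ℕ.+ suc b ℕ.≤? 47
    ... | yes ≤47 = medium-sum (ℕ.s≤s a≤b) ≥12 ≤47
    ... | no  ≰47 = Gap-sym (suc b) (suc a) (Step.gap a (suc b) (ℕ.s≤s a≤b) 24≤b
      λ c d ≥12 <n → ih (subst (suc c ℕ.+ suc d ℕ.<_) (ℕₚ.+-comm (suc b) (suc a)) <n)
        c d ≥12 refl)
      where
      24≤b : 24 ℕ.≤ suc b
      -- If the larger index were at most 23, the sum would be at most 46.
      24≤b = ℕₚ.≮⇒≥ λ b<24 → ≰47 (ℕₚ.≤-trans
        (ℕₚ.+-mono-≤ (ℕₚ.≤-trans (ℕ.s≤s a≤b) (ℕₚ.≤-pred b<24)) (ℕₚ.≤-pred b<24)) (ℕₚ.m≤m+n 46 1))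

    gaps : ∀ n → GapsAt n
    gaps = <-rec GapsAt step
      where
      step : ∀ n → (∀ {m} → m ℕ.< n → GapsAt m) → GapsAt n
      step n ih a b ≥12 refl = [ (λ a≤b → ordered-gap a b a≤b ≥12 ih)
        , (λ b≤a → Gap-sym (suc b) (suc a) (ordered-gap b a b≤a
            (subst (12 ℕ.≤_) (ℕₚ.+-comm (suc a) (suc b)) ≥12)
            (λ {m} m< → ih (subst (m ℕ.<_) (ℕₚ.+-comm (suc b) (suc a)) m<))))
        ]′ (ℕₚ.≤-total a b)

  -- Transfer to Cauchy reals

  ι*1/ : ∀ n → ι (suc n) * (ℤ.+ 1 / suc n) ≡ 1ℚ
  ι*1/ n = toℚᵘ-injective (begin-equality
    toℚᵘ (ι (suc n) * (ℤ.+ 1 / suc n))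
      ≃⟨ toℚᵘ-homo-* (ι (suc n)) (ℤ.+ 1 / suc n) ⟩
    toℚᵘ (ι (suc n)) ℚᵘ.* toℚᵘ (ℤ.+ 1 / suc n)
      ≃⟨ ℚᵘₚ.*-cong (toℚᵘ-ι (suc n)) (toℚᵘ-fromℚᵘ (mkℚᵘ (ℤ.+ 1) n)) ⟩
    mkℚᵘ (ℤ.+ suc n) 0 ℚᵘ.* mkℚᵘ (ℤ.+ 1) n
      ≃⟨ *≡* (trans (trans (ℤₚ.*-identityʳ (ℤ.+ suc n ℤ.* ℤ.+ 1)) (ℤₚ.*-identityʳ (ℤ.+ suc n)))
           (sym (trans (ℤₚ.*-identityˡ (ℤ.+ (1 ℕ.* suc n)))
             (cong ℤ.+_ (ℕₚ.*-identityˡ (suc n)))))) ⟩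
    toℚᵘ 1ℚ ∎)
    where
    open ℚᵘₚ.≤-Reasoning
    import Data.Nat.Properties as ℕₚ

  seq-sumℝ : ∀ n (g : ℕ → ℝ) m → seq (sumℝ {n} (λ i → g (toℕ i))) m ≡ ∑ n (λ i → seq (g i) m)
  seq-sumℝ zero    g m = refl
  seq-sumℝ (suc n) g m = cong (λ q → seq (g 0) m + q) (seq-sumℝ n (λ i → g (suc i)) m)

  -- Real operations act termwise, so the m-th approximation of Pₙ(x) obeys the recurrence at the
  -- rational `seq x m` once the division by n is multiplied out.
  seq-P-recurrence : ∀ x m n →
    ι n * seq (P n x) m ≡ seq x m * ∑ n (λ i → divisor-weight i * seq (P (n ℕ.∸ suc i) x) m)
  seq-P-recurrence x m zero    = trans (*-zeroˡ (seq (P 0 x) m)) (sym (*-zeroʳ (seq x m)))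
  seq-P-recurrence x m (suc n) = begin
    ι (suc n) * seq (P (suc n) x) m
      ≡⟨ cong (λ y → ι (suc n) * seq y m) (P-suc n x) ⟩
    ι (suc n) * (seq x m * (ℤ.+ 1 / suc n) * seq (sumℝ {suc n} (λ i → g (toℕ i))) m)
      ≡⟨ cong (λ q → ι (suc n) * (seq x m * (ℤ.+ 1 / suc n) * q)) (seq-sumℝ (suc n) g m) ⟩
    ι (suc n) * (seq x m * (ℤ.+ 1 / suc n) * S)
      ≡⟨ solve 4 (λ k x r s → k :* (x :* r :* s) := k :* r :* (x :* s)) refl
           (ι (suc n)) (seq x m) (ℤ.+ 1 / suc n) S ⟩
    ι (suc n) * (ℤ.+ 1 / suc n) * (seq x m * S)
      ≡⟨ cong (_* (seq x m * S)) (ι*1/ n) ⟩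
    1ℚ * (seq x m * S)
      ≡⟨ *-identityˡ (seq x m * S) ⟩
    seq x m * S ∎
    where
    open ≡-Reasoning
    g : ℕ → ℝ
    g i = fromℕ (σ₂ (suc i)) *ℝ P (suc n ℕ.∸ suc i) x
    S : ℚ
    S = ∑ (suc n) (λ i → divisor-weight i * seq (P (n ℕ.∸ i) x) m)

  -- The tolerance 1/100 is the distance from 2 down to 1.99, so this is the nonnegativity of z =
  -- 100 x - 199.
  near-2 : ∀ x → ι 2 < x + ℤ.+ 1 / 100 → 0ℚ ≤ ι 100 * x - ι 199
  near-2 x 2<x+1/100 = subst₂ _≤_ refl
    (solve 1 (λ x → con (ι 100) :* (x :+ con (ℤ.+ 1 / 100)) :- con (ι 200) :=
       con (ι 100) :* x :- con (ι 199)) refl x)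
    (+-monoˡ-≤ (- ι 200) (*-monoʳ-≤-0≤ {ι 100} (0≤ι 100) (<⇒≤ 2<x+1/100)))

  P-gap : ∀ x → x ≥ℝ fromℕ 2 → ∀ a b → 12 ℕ.≤ suc a ℕ.+ suc b →
    P (suc a) x *ℝ P (suc b) x >ℝ P (suc a ℕ.+ suc b) x
  P-gap x x≥2 a b ≥12 =
    let N , near = x≥2 (ℤ.+ 1 / 100) (positive⁻¹ (ℤ.+ 1 / 100))
    -- Any positive gap below 1 would do: from `N` on, the approximations differ by at least 1.
    in ½ , positive⁻¹ ½ , N , λ m N≤m →
      <-≤-trans (+-monoʳ-< (seq (P (suc a ℕ.+ suc b) x) m) ½<1) (gap m (near m N≤m))
    where
    ½<1 : ½ < 1ℚ
    ½<1 = *<* (ℤ.+<+ (ℕ.s≤s (ℕ.s≤s ℕ.z≤n)))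
    gap : ∀ m → ι 2 < seq x m + ℤ.+ 1 / 100 →
      seq (P (suc a ℕ.+ suc b) x) m + 1ℚ ≤ seq (P (suc a) x) m * seq (P (suc b) x) m
    gap m 2<xₘ+1/100 = Recurrence.gaps (seq x m) (λ n → seq (P n x) m) refl
      (seq-P-recurrence x m) (ι 100 * seq x m - ι 199) (near-2 (seq x m) 2<xₘ+1/100)
      (solve 1 (λ x → con (ι 100) :* x := con (ι 199) :+ (con (ι 100) :* x :- con (ι 199)))
        refl (seq x m))
      (suc a ℕ.+ suc b) a b ≥12 refl

open import Data.Nat using (_+_; _≥_)

theorem1p4 : (x : ℝ) → x ≥ℝ fromℕ 2 →
    (a b : ℕ) → a ≥ 1 → b ≥ 1 → a + b ≥ 12 →
    P a x *ℝ P b x >ℝ P (a + b) x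
theorem1p4 x x≥2 (suc a) (suc b) a≥1 b≥1 ≥12 = P-gap x x≥2 a b ≥12
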